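{- For every integer $n\ge 1$, the partition graph $G_n$, and hence the clique complex $K_n$ of $G_n$, is connected.
   Context: A partition of a positive integer $n$ is a weakly decreasing sequence $\lambda=(\lambda_1\ge\cdots\ge\lambda_\ell>0)$ of positive integers with sum $n$; it is identified with its Ferrers diagram, the left-justified array with $\lambda_i$ cells in row $i$. The partition graph $G_n$ is the simple graph whose vertices are all partitions of $n$; two distinct partitions are adjacent if one can be obtained from the other by removing one cell from a row of the Ferrers diagram, adding it to another row (possibly a new row, i.e. a row of length $0$), and then reordering the row lengths into weakly decreasing order (discarding zeros). $K_n:=\mathrm{Cl}(G_n)$ is the clique complex of $G_n$: the simplicial complex whose simplices are the finite nonempty cliques of $G_n$. -}

module Defs where

open import Data.Fin using (Fin)
open import Data.List using (List; []; _∷_; _++_; filter; length; sum)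
open import Data.List.Membership.Propositional using (_∈_)
open import Data.List.Relation.Binary.Permutation.Propositional using (_↭_)
open import Data.List.Relation.Binary.Subset.Propositional using (_⊆_)
open import Data.List.Relation.Unary.All using (All)
open import Data.List.Relation.Unary.Any using (here)
open import Data.List.Relation.Unary.Linked using (Linked)
open import Data.Nat using (ℕ; suc; pred; _<_; _≥_; _<?_)
open import Data.Product using (_×_; _,_; ∃-syntax)
open import Data.Sum using (_⊎_; swap)
open import Data.Vec using (Vec; fromList; lookup; toList; updateAt)
open import Relation.Binary.Construct.Closure.ReflexiveTransitive using (Star)
open import Relation.Binary.Definitions using (Symmetric)
open import Relation.Binary.PropositionalEquality using (_≡_; _≢_; refl; sym; trans)
open import Relation.Nullary using (¬_; contradiction)

record SimpleGraph : Set₁ where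
  infix 4 _~_
  field
    Vertex  : Set
    _~_     : Vertex → Vertex → Set
    ~-sym   : Symmetric _~_
    ~-irrefl : ∀ {v} → ¬ (v ~ v)

-- The empty graph does not count as connected.
GraphConnected : SimpleGraph → Set
GraphConnected G = Vertex × (∀ u v → Star _~_ u v)
  where open SimpleGraph G

-- A list stands for the finite set of its members, so order and repetitions
-- are immaterial; `down-closed` makes `IsSimplex` invariant under both.
record SimplicialComplex : Set₁ where
  field
    Vertex      : Set
    IsSimplex   : List Vertex → Set
    nonempty    : ¬ IsSimplex []
    vertex      : ∀ v → IsSimplex (v ∷ [])
    down-closed : ∀ {σ τ} → IsSimplex σ → τ ⊆ σ → τ ≢ [] → IsSimplex τ

-- Combinatorial connectedness: there is a vertex, and any two vertices are
-- joined by an edge path.  A step may be degenerate, {u , u} = {u}.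
ComplexConnected : SimplicialComplex → Set
ComplexConnected K = Vertex × (∀ u v → Star (λ x y → IsSimplex (x ∷ y ∷ [])) u v)
  where open SimplicialComplex K

IsClique : (G : SimpleGraph) → List (SimpleGraph.Vertex G) → Set
IsClique G σ = ∀ {u v} → u ∈ σ → v ∈ σ → u ≢ v → u ~ v
  where open SimpleGraph G

Cl : SimpleGraph → SimplicialComplex
Cl G = record
  { Vertex      = SimpleGraph.Vertex G
  ; IsSimplex   = λ σ → σ ≢ [] × IsClique G σ
  ; nonempty    = λ (ne , _) → ne refl
  ; vertex      = λ v → (λ ()) , λ where
      (here p) (here q) u≢v → contradiction (trans p (sym q)) u≢v
  ; down-closed = λ (_ , clique) τ⊆σ τ≢[] →
      τ≢[] , λ u∈τ v∈τ → clique (τ⊆σ u∈τ) (τ⊆σ v∈τ)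
  }

-- The last three fields are proof-irrelevant types, so p ≡ q amounts to
-- parts p ≡ parts q.
record Partition (n : ℕ) : Set where
  field
    parts      : List ℕ
    decreasing : Linked _≥_ parts
    positive   : All (0 <_) parts
    sum-parts  : sum parts ≡ n

open Partition public

-- The rows of the Ferrers diagram followed by one empty row, which is the
-- possible new row.
rows : ∀ {n} (p : Partition n) → Vec ℕ (length (parts p ++ 0 ∷ []))
rows p = fromList (parts p ++ 0 ∷ [])

moveCell : ∀ {k} → Vec ℕ k → (i j : Fin k) → Vec ℕ k
moveCell r i j = updateAt (updateAt r i pred) j suc

-- Reordering is expressed by ↭: since the parts of q are already weakly
-- decreasing, they are the sorted form of the nonzero modified row lengths.
CellMove : ∀ {n} → Partition n → Partition n → Set
CellMove p q =
  ∃[ i ] ∃[ j ] i ≢ j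
    × 0 < lookup (rows p) i
    × filter (0 <?_) (toList (moveCell (rows p) i j)) ↭ parts q

G : ℕ → SimpleGraph
G n = record
  { Vertex   = Partition n
  ; _~_      = λ p q → p ≢ q × (CellMove p q ⊎ CellMove q p)
  ; ~-sym    = λ (p≢q , m) → (λ q≡p → p≢q (sym q≡p)) , swap m
  ; ~-irrefl = λ (p≢p , _) → p≢p refl
  }

K : ℕ → SimplicialComplex
K n = Cl (G n)

{-# OPTIONS --safe #-}
-- Moving a cell from the last row to the first keeps the row lengths weakly
-- decreasing and shrinks the total of the remaining rows, so iterating it
-- joins every partition to the one-row partition (n).
module Submission where

open import Data.Fin using (Fin; zero; suc)
open import Data.List using (List; []; _∷_; _++_; filter; length)
open import Data.List.Properties using (filter-++; ++-identityʳ; ∷-injectiveˡ)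
open import Data.List.Relation.Binary.Permutation.Propositional using (↭-reflexive)
open import Data.List.Relation.Unary.All as All using (All; []; _∷_)
open import Data.List.Relation.Unary.All.Properties using (all-filter)
open import Data.List.Relation.Unary.Any using (here; there)
open import Data.List.Relation.Unary.Linked as Linked using (Linked; [-]; _∷_)
import Data.List.Relation.Unary.Linked.Properties as Linked
open import Data.Nat using (ℕ; zero; suc; pred; _+_; _≤_; _<_; _≥_; _<?_)
open import Data.Nat.ListAction using (sum)
open import Data.Nat.Properties
open import Data.Product using (_×_; _,_)
open import Data.Sum using (inj₁)
open import Data.Vec using (fromList; lookup; toList; updateAt)
open import Relation.Binary.Construct.Closure.ReflexiveTransitive as Star
  using (Star; ε; _◅_; _◅◅_)
open import Relation.Binary.PropositionalEquality
open import Relation.Nullary using (contradiction)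
open import Defs

-- Serves to recognise the single row `n` at the end of a chain of moves, where the proof fields are
-- built differently.
parts-injective : ∀ {n} {p q : Partition n} → parts p ≡ parts q → p ≡ q
parts-injective
  {p = record { decreasing = d ; positive = z ; sum-parts = s }}
  {q = record { decreasing = d′ ; positive = z′ ; sum-parts = s′ }} refl
  with refl ← Linked.irrelevant ≤-irrelevant d d′
     | refl ← All.irrelevant <-irrelevant z z′
     | refl ← ≡-irrelevant s s′ = refl

-- A last row of length 1 stays as a trailing 0 until a filter drops it, so the number of rows
-- agrees with the vector that `moveCell` returns.
predLast : ℕ → List ℕ → List ℕ
predLast x []       = pred x ∷ []
predLast x (y ∷ ys) = x ∷ predLast y ys

lastRow : ∀ x xs → Fin (length (x ∷ xs ++ 0 ∷ []))
lastRow x []       = zero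
lastRow x (y ∷ ys) = suc (lastRow y ys)

lookup-lastRow : ∀ x xs → All (0 <_) (x ∷ xs) →
                 0 < lookup (fromList (x ∷ xs ++ 0 ∷ [])) (lastRow x xs)
lookup-lastRow x []       (0<x ∷ _)  = 0<x
lookup-lastRow x (y ∷ ys) (_ ∷ 0<ys) = lookup-lastRow y ys 0<ys

updateAt-lastRow : ∀ x xs →
  toList (updateAt (fromList (x ∷ xs ++ 0 ∷ [])) (lastRow x xs) pred)
    ≡ predLast x xs ++ 0 ∷ []
updateAt-lastRow x []       = refl
updateAt-lastRow x (y ∷ ys) = cong (x ∷_) (updateAt-lastRow y ys)

-- No row follows the last one, so shortening it breaks no inequality. The row `c` above is carried
-- along so that the induction can restore each link.
predLast-decreasing : ∀ {c} x xs → Linked _≥_ (c ∷ x ∷ xs) → Linked _≥_ (c ∷ predLast x xs)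
predLast-decreasing x []       (c≥x ∷ _) = ≤-trans pred[n]≤n c≥x ∷ [-]
predLast-decreasing x (y ∷ ys) (c≥x ∷ d) = c≥x ∷ predLast-decreasing y ys d

suc-head-decreasing : ∀ {c xs} → Linked _≥_ (c ∷ xs) → Linked _≥_ (suc c ∷ xs)
suc-head-decreasing [-]       = [-]
suc-head-decreasing (c≥x ∷ d) = m≤n⇒m≤1+n c≥x ∷ d

-- Positivity matters at the last row, where `pred 0` would lose no cell.
sum-predLast : ∀ x xs → All (0 <_) (x ∷ xs) → suc (sum (predLast x xs)) ≡ sum (x ∷ xs)
sum-predLast (suc x) []       _          = refl
sum-predLast x       (y ∷ ys) (_ ∷ 0<ys) =
  trans (sym (+-suc x _)) (cong (x +_) (sum-predLast y ys 0<ys))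

sum-filter-positive : ∀ xs → sum (filter (0 <?_) xs) ≡ sum xs
sum-filter-positive []           = refl
sum-filter-positive (zero  ∷ xs) = sum-filter-positive xs
sum-filter-positive (suc x ∷ xs) = cong (suc x +_) (sum-filter-positive xs)

filter-positive-++0 : ∀ xs → filter (0 <?_) (xs ++ 0 ∷ []) ≡ filter (0 <?_) xs
filter-positive-++0 xs = trans (filter-++ (0 <?_) xs (0 ∷ [])) (++-identityʳ _)

module _ {n a x xs} (d : Linked _≥_ (a ∷ x ∷ xs)) (pos : All (0 <_) (a ∷ x ∷ xs))
         (s : sum (a ∷ x ∷ xs) ≡ n) where

  lastToFirst : Partition n
  lastToFirst = record
    { parts      = filter (0 <?_) (suc a ∷ predLast x xs)
    ; decreasing = Linked.filter⁺ (0 <?_) (λ i≥j j≥k → ≤-trans j≥k i≥j)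
                     (suc-head-decreasing (predLast-decreasing x xs d))
    ; positive   = all-filter (0 <?_) (suc a ∷ predLast x xs)
    ; sum-parts  = begin
        sum (filter (0 <?_) (suc a ∷ predLast x xs)) ≡⟨ sum-filter-positive (suc a ∷ predLast x xs) ⟩
        suc a + sum (predLast x xs)                  ≡⟨ +-suc a _ ⟨
        a + suc (sum (predLast x xs))                ≡⟨ cong (a +_) (sum-predLast x xs (All.tail pos)) ⟩
        a + sum (x ∷ xs)                             ≡⟨ s ⟩
        n                                            ∎
    }
    where open ≡-Reasoning

  lastToFirst-adjacent :
    SimpleGraph._~_ (G n)
      (record { parts = a ∷ x ∷ xs ; decreasing = d ; positive = pos ; sum-parts = s })
      lastToFirst
  lastToFirst-adjacent =
    -- The two partitions already differ in the first row: `a` against `suc a`.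
    (λ p≡q → 1+n≢n (sym (∷-injectiveˡ (cong parts p≡q)))) ,
    -- `lastRow` counts from the second row, hence the `suc`. The result is already sorted, so the
    -- permutation is an equality once the filter discards the empty row appended by `rows`.
    inj₁ (suc (lastRow x xs) , zero , (λ ()) , lookup-lastRow x xs (All.tail pos) ,
          ↭-reflexive (trans (cong (λ r → filter (0 <?_) (suc a ∷ r)) (updateAt-lastRow x xs))
                             (filter-positive-++0 (suc a ∷ predLast x xs))))

oneRow : ∀ n → n ≥ 1 → Partition n
oneRow n n≥1 = record
  { parts = n ∷ [] ; decreasing = [-] ; positive = n≥1 ∷ [] ; sum-parts = +-identityʳ n }

-- Induction on the bound `k`, since `lastToFirst` is not a structural subterm of `p`.
joined-to-oneRow : ∀ {n} (n≥1 : n ≥ 1) k (p : Partition n) {a l} → parts p ≡ a ∷ l → sum l ≤ k →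
                   Star (SimpleGraph._~_ (G n)) p (oneRow n n≥1)
joined-to-oneRow n≥1 k p@(record { parts = a ∷ [] ; sum-parts = s }) refl _ =
  -- A single row must have length `n`, so the empty path suffices.
  subst (Star _ p) (parts-injective (cong (_∷ []) (trans (sym (+-identityʳ a)) s))) ε
joined-to-oneRow n≥1 zero (record { parts = a ∷ x ∷ xs ; positive = _ ∷ 0<x ∷ _ }) refl l≤0 =
  -- A second row is positive, so the rows below the first cannot total 0.
  contradiction (≤-trans (m≤m+n x (sum xs)) l≤0) (<⇒≱ 0<x)
joined-to-oneRow n≥1 (suc k)
  (record { parts = a ∷ x ∷ xs ; decreasing = d ; positive = pos ; sum-parts = s }) refl l≤1+k =
  lastToFirst-adjacent d pos s ◅
  joined-to-oneRow n≥1 k (lastToFirst d pos s) refl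
    -- Dropping zeros keeps the sum and the move takes one cell from the lower rows, so the bound
    -- falls to `k`.
    (≤-trans (≤-reflexive (sum-filter-positive (predLast x xs)))
      (≤-pred (≤-trans (≤-reflexive (sum-predLast x xs (All.tail pos))) l≤1+k)))

G-connected : ∀ n → n ≥ 1 → GraphConnected (G n)
G-connected n n≥1 = oneRow n n≥1 , λ u v → toOneRow u ◅◅ Star.reverse ~-sym (toOneRow v)
  where
  open SimpleGraph (G n)
  toOneRow : ∀ p → Star _~_ p (oneRow n n≥1)
  toOneRow (record { parts = [] ; sum-parts = 0≡n }) = contradiction 0≡n (<⇒≢ n≥1)
  toOneRow p@(record { parts = _ ∷ _ }) = joined-to-oneRow n≥1 _ p refl ≤-refl

-- Adjacent vertices form a two-element clique, so a path in the graph is an edge path in the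
-- complex.
Cl-connected : ∀ Γ → GraphConnected Γ → ComplexConnected (Cl Γ)
Cl-connected Γ (v₀ , path) = v₀ , λ u v → Star.map edge (path u v)
  where
  open SimpleGraph Γ
  edge : ∀ {x y} → x ~ y → SimplicialComplex.IsSimplex (Cl Γ) (x ∷ y ∷ [])
  edge x~y = (λ ()) , λ where
    (here refl)         (here refl)         u≢v → contradiction refl u≢v
    (here refl)         (there (here refl)) _   → x~y
    (there (here refl)) (here refl)         _   → ~-sym x~y
    (there (here refl)) (there (here refl)) u≢v → contradiction refl u≢v

proposition6p1 : (n : ℕ) → n ≥ 1 → GraphConnected (G n) × ComplexConnected (K n)
proposition6p1 n n≥1 = connected , Cl-connected (G n) connected
  where connected = G-connected n n≥1
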